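{- Let $G$ be a simple plane graph on $n\geq 5$ vertices with minimum degree $\delta(G)\geq 3$ that contains neither $K_4$ nor $C_5$ as a subgraph. Then $e(G)\leq \frac{15}{7}(n-2)$.
   Context: $K_4$ is the complete graph on $4$ vertices, $C_5$ the cycle on $5$ vertices; $e(G)$ is the number of edges of $G$. "Contains as a subgraph" means not necessarily induced. -}

module Defs where

open import Data.Bool using (Bool; false; not; T; T?; _∨_)
open import Data.Fin using (Fin; toℕ; _<?_)
open import Data.Fin.Properties using (_≟_; all?)
open import Data.Fin.Subset using (Subset; ∣_∣)
open import Data.List using (List; length; filter; allFin; cartesianProduct)
open import Data.Nat as ℕ using (ℕ; suc; _+_; _*_; _≡ᵇ_)
open import Data.Nat.DivMod using (_%_)
open import Data.Nat.GeneralisedArithmetic using (iterate)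
open import Data.Product using (Σ; ∃-syntax; _×_; _,_)
open import Data.Vec using (tabulate)
import Data.Bool.Properties as Bool
open import Function using (_∘_)
open import Function.Bundles using (_⇔_)
open import Function.Definitions using (Injective; Surjective)
open import Relation.Binary.Construct.Closure.ReflexiveTransitive using (Star)
open import Relation.Binary.PropositionalEquality using (_≡_; subst)
open import Relation.Nullary.Decidable using (does; _×-dec_; from-yes)

record SimpleGraph (n : ℕ) : Set where
  field
    adj        : Fin n → Fin n → Bool
    adj-sym    : ∀ u v → adj u v ≡ adj v u
    adj-irrefl : ∀ v → adj v v ≡ false

  Adj : Fin n → Fin n → Set
  Adj u v = T (adj u v)

  neighbours : Fin n → Subset n
  neighbours v = tabulate (adj v)

  degree : Fin n → ℕ
  degree v = ∣ neighbours v ∣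

  -- Each edge is listed once, as the pair (u , v) of its ends with u < v.
  edges : List (Fin n × Fin n)
  edges = filter (λ (u , v) → (u <? v) ×-dec T? (adj u v))
                 (cartesianProduct (allFin n) (allFin n))

  e : ℕ
  e = length edges

  isolated : List (Fin n)
  isolated = filter (λ v → degree v ℕ.≟ 0) (allFin n)

  Connected : Fin n → Fin n → Set
  Connected = Star Adj

  -- An edge with a direction; every edge gives two darts.
  record Dart : Set where
    eta-equality
    constructor dart
    field
      tail head  : Fin n
      .tail~head : Adj tail head

  reverse : Dart → Dart
  reverse (dart u v u~v) = dart v u (subst T (adj-sym u v) u~v)

-- H is a (not necessarily induced) subgraph of G, up to isomorphism.
_⊑_ : ∀ {m n} → SimpleGraph m → SimpleGraph n → Set
_⊑_ {m} {n} H G =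
  Σ (Fin m → Fin n) λ f →
    Injective _≡_ _≡_ f × (∀ u v → H.Adj u v → G.Adj (f u) (f v))
  where
    module H = SimpleGraph H
    module G = SimpleGraph G

K₄ : SimpleGraph 4
K₄ = record
  { adj        = k
  ; adj-sym    = from-yes (all? λ u → all? λ v → k u v Bool.≟ k v u)
  ; adj-irrefl = from-yes (all? λ v → k v v Bool.≟ false)
  }
  where
    k : Fin 4 → Fin 4 → Bool
    k u v = not (does (u ≟ v))

C₅ : SimpleGraph 5
C₅ = record
  { adj        = c
  ; adj-sym    = from-yes (all? λ u → all? λ v → c u v Bool.≟ c v u)
  ; adj-irrefl = from-yes (all? λ v → c v v Bool.≟ false)
  }
  where
    c : Fin 5 → Fin 5 → Bool
    c u v = (suc (toℕ u) % 5 ≡ᵇ toℕ v) ∨ (suc (toℕ v) % 5 ≡ᵇ toℕ u)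

SameOrbit : {A : Set} → (A → A) → A → A → Set
SameOrbit f x y = ∃[ k ] iterate f x k ≡ y

-- The relation _~_ on A is an equivalence with exactly `count` classes.
record Classes {A : Set} (_~_ : A → A → Set) : Set where
  field
    count      : ℕ
    class      : A → Fin count
    surjective : Surjective _≡_ _≡_ class
    class-≡    : ∀ x y → (class x ≡ class y) ⇔ (x ~ y)

-- A simple graph with an embedding in the plane, in the combinatorial sense:
-- a rotation system of genus 0.  `rotate d` is the dart that follows d in the
-- cyclic order around tail d.
--
-- The orbits of `rotate ∘ reverse` are the facial walks having at least one
-- edge; an isolated vertex contributes one further, trivial, facial walk.
-- Each component, embedded on its own sphere, has Euler characteristic
-- V - E + F = 2 - 2 · genus, so `euler`, which sums this over the components,
-- says that all of them have genus 0.  The formula n - e + f = 1 + c for a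
-- graph with c components counts instead the faces of the plane; there, a face
-- may be bounded by several facial walks.
record PlaneGraph (n : ℕ) : Set where
  field
    graph : SimpleGraph n
  open SimpleGraph graph public
  field
    rotate           : Dart → Dart
    rotate-injective : Injective _≡_ _≡_ rotate
    rotate-orbits    : ∀ d d′ → SameOrbit rotate d d′ ⇔ (Dart.tail d ≡ Dart.tail d′)

  nextOnFace : Dart → Dart
  nextOnFace = rotate ∘ reverse

  field
    facialWalks : Classes (SameOrbit nextOnFace)
    components  : Classes Connected

  numFacialWalks : ℕ
  numFacialWalks = Classes.count facialWalks + length isolated

  field
    euler : n + numFacialWalks ≡ e + 2 * Classes.count components

{-# OPTIONS --safe #-}

-- Discharging.  Every dart starts with charge 8, and a dart on a facial walk of
-- length at least 6 gives up 3, which the reverse dart receives if it lies on a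
-- triangular face.  As δ ≥ 3, facial walks do not backtrack, so those of length 3, 4 and 5
-- are cycles; there are none of length 5.  If a triangular face shared edges
-- with two triangular faces, or with one quadrangular face, there would be a K₄
-- or a C₅.  Hence the two darts of an edge end with at most 16, while a facial
-- walk ends with at least 8 + 11 + 11 (length 3), 4 · 8 (length 4) or 6 · 5, so
-- at least 30 in all cases.  So 30 f ≤ 16 e, and Euler's formula concludes.

module Submission where

open import Defs
open import Data.Bool using (T; T?)
open import Data.Bool.Properties using (T-≡)
open import Data.Empty using (⊥; ⊥-elim)
open import Data.Fin as Fin using (Fin)
open import Data.Fin.Patterns
open import Data.Fin.Properties using (_≟_; any?; <-cmp)
open import Data.Fin.Subset using (Subset; ∣_∣; _∪_; ⁅_⁆; inside; outside) renaming (_⊆_ to _⊆ₛ_)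
open import Data.Fin.Subset.Properties using (p⊆q⇒∣p∣≤∣q∣; ∣⁅x⁆∣≡1; x∈p∪q⁺; x∈⁅x⁆)
open import Data.Integer as ℤ using (+_)
import Data.Integer.Properties as ℤ
open import Data.List using (List; []; _∷_; _++_; [_]; map; concat; concatMap; length; applyUpTo; allFin)
open import Data.List.Membership.Propositional using (_∈_)
open import Data.List.Membership.Propositional.Properties using (∈-∃++; ∈-++⁺ˡ; ∈-++⁺ʳ; ∈-++⁻; ∈-concatMap⁺; ∈-filter⁺; ∈-cartesianProduct⁺; ∈-allFin; ∈-applyUpTo⁻)
open import Data.List.Properties using (map-++; filter-none; length-tabulate)
open import Data.List.Relation.Unary.All as All using (All; []; _∷_)
import Data.List.Relation.Unary.All.Properties as All
open import Data.List.Relation.Unary.AllPairs using ([]; _∷_)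
import Data.List.Relation.Unary.AllPairs.Properties as AllPairs
open import Data.List.Relation.Unary.Any as Any using (here; there)
open import Data.List.Relation.Unary.Unique.Propositional using (Unique)
import Data.List.Relation.Unary.Unique.Propositional.Properties as Unique
open import Data.Nat as ℕ using (ℕ; zero; suc; s≤s; z≤n; _∸_)
open import Data.Nat.GeneralisedArithmetic using (iterate)
open import Data.Nat.ListAction using (sum)
open import Data.Nat.ListAction.Properties using (sum-++)
import Data.Nat.Properties as ℕ
open import Data.Nat.Solver using (module +-*-Solver)
open import Data.Product using (_×_; _,_; ∃-syntax; proj₁; proj₂)
open import Data.Rational using (_/_; _≤_; _*_; toℚᵘ)
import Data.Rational.Properties as ℚ
open import Data.Rational.Unnormalised as ℚᵘ using (mkℚᵘ; *≤*)
import Data.Rational.Unnormalised.Properties as ℚᵘ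
open import Data.Sum using (_⊎_; inj₁; inj₂)
open import Data.Vec using (lookup; _∷_; [])
open import Data.Vec.Properties using ([]=⇒lookup; lookup∘tabulate)
open import Function using (_∘_; Equivalence)
open import Function.Definitions using (Injective)
open import Relation.Binary.Definitions using (tri<; tri≈; tri>)
open import Relation.Binary.PropositionalEquality using (_≡_; _≢_; refl; sym; trans; cong; cong₂; subst; subst₂; ≢-sym)
open import Relation.Nullary using (¬_; Dec; yes; no)
open import Relation.Nullary.Decidable using (_×-dec_; ¬?; recompute; map′)

-- Counting tools: finite subsets and iterates of an injective map.

∣p∪q∣≤∣p∣+∣q∣ : ∀ {n} (p q : Subset n) → ∣ p ∪ q ∣ ℕ.≤ ∣ p ∣ ℕ.+ ∣ q ∣
∣p∪q∣≤∣p∣+∣q∣ []            []            = z≤n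
∣p∪q∣≤∣p∣+∣q∣ (outside ∷ p) (outside ∷ q) = ∣p∪q∣≤∣p∣+∣q∣ p q
∣p∪q∣≤∣p∣+∣q∣ (outside ∷ p) (inside  ∷ q) =
  ℕ.≤-trans (s≤s (∣p∪q∣≤∣p∣+∣q∣ p q)) (ℕ.≤-reflexive (sym (ℕ.+-suc ∣ p ∣ ∣ q ∣)))
∣p∪q∣≤∣p∣+∣q∣ (inside  ∷ p) (outside ∷ q) = s≤s (∣p∪q∣≤∣p∣+∣q∣ p q)
∣p∪q∣≤∣p∣+∣q∣ (inside  ∷ p) (inside  ∷ q) =
  s≤s (ℕ.≤-trans (∣p∪q∣≤∣p∣+∣q∣ p q) (ℕ.+-monoʳ-≤ ∣ p ∣ (ℕ.n≤1+n ∣ q ∣)))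

iterate-comm : {A : Set} (f : A → A) → ∀ x k → iterate f (f x) k ≡ f (iterate f x k)
iterate-comm f x zero    = refl
iterate-comm f x (suc k) = iterate-comm f (f x) k

module _ {A : Set} {f : A → A} (f-injective : Injective _≡_ _≡_ f) where

  iterate-cancel : ∀ x {i j} → i ℕ.≤ j → iterate f x i ≡ iterate f x j → x ≡ iterate f x (j ∸ i)
  iterate-cancel x z≤n eq = eq
  iterate-cancel x {suc i} {suc j} (s≤s i≤j) eq =
    f-injective (trans (iterate-cancel (f x) i≤j eq) (iterate-comm f x (j ∸ i)))

  -- If iterates `i < j` coincide, cancelling `i` applications of `f` turns `j ∸ i` into a period of
  -- `x` that is positive and below `k`.
  iterate-unique : ∀ x k → (∀ m → 0 ℕ.< m → m ℕ.< k → x ≢ iterate f x m) →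
                   Unique (applyUpTo (iterate f x) k)
  iterate-unique x k aperiodic = Unique.applyUpTo⁺₁ (iterate f x) k λ {i} {j} i<j j<k eq →
    aperiodic (j ∸ i) (ℕ.m<n⇒0<n∸m i<j) (ℕ.≤-<-trans (ℕ.m∸n≤m j i) j<k)
              (iterate-cancel x (ℕ.<⇒≤ i<j) eq)

-- Weighted sums over lists.

module _ {A : Set} (w : A → ℕ) where

  total : List A → ℕ
  total xs = sum (map w xs)

  total-++ : ∀ xs ys → total (xs ++ ys) ≡ total xs ℕ.+ total ys
  total-++ xs ys = trans (cong sum (map-++ w xs ys)) (sum-++ (map w xs) (map w ys))

  total-insert : ∀ x ys zs → total (ys ++ [ x ] ++ zs) ≡ w x ℕ.+ total (ys ++ zs)
  total-insert x ys zs rewrite total-++ ys (x ∷ zs) | total-++ ys zs =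
    solve 3 (λ a b c → b :+ (a :+ c) := a :+ (b :+ c)) refl (w x) (total ys) (total zs)
    where open +-*-Solver

  -- Each entry of `xs` is removed from `ys` in turn; uniqueness of `xs` keeps the later entries in
  -- what remains. An enumeration such as `darts` can thus serve as `ys` as soon as it is complete.
  total-mono : ∀ {xs ys} → Unique xs → (∀ {x} → x ∈ xs → x ∈ ys) → total xs ℕ.≤ total ys
  total-mono [] _ = z≤n
  total-mono {x ∷ xs} {ys} (x∉xs ∷ uniq) xs⊆ys with ∈-∃++ (xs⊆ys (here refl))
  ... | as , bs , refl = ℕ.≤-trans
    (ℕ.+-monoʳ-≤ (w x) (total-mono uniq skip)) (ℕ.≤-reflexive (sym (total-insert x as bs)))
    where
      skip : ∀ {y} → y ∈ xs → y ∈ as ++ bs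
      skip y∈xs with ∈-++⁻ as (xs⊆ys (there y∈xs))
      ... | inj₁ y∈as         = ∈-++⁺ˡ y∈as
      ... | inj₂ (here y≡x)   = ⊥-elim (All.lookup x∉xs y∈xs (sym y≡x))
      ... | inj₂ (there y∈bs) = ∈-++⁺ʳ as y∈bs

  total-concat : ∀ {c xss} → All (λ xs → c ℕ.≤ total xs) xss → length xss ℕ.* c ℕ.≤ total (concat xss)
  total-concat [] = z≤n
  total-concat {c} {xs ∷ xss} (c≤ ∷ cs≤) = ℕ.≤-trans
    (ℕ.+-mono-≤ c≤ (total-concat cs≤)) (ℕ.≤-reflexive (sym (total-++ xs (concat xss))))

  total-concatMap : ∀ {B : Set} {c} {f : B → List A} → (∀ y → total (f y) ℕ.≤ c) →
                    ∀ ys → total (concatMap f ys) ℕ.≤ length ys ℕ.* c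
  total-concatMap f≤ [] = z≤n
  total-concatMap {f = f} f≤ (y ∷ ys) = ℕ.≤-trans
    (ℕ.≤-reflexive (total-++ (f y) (concatMap f ys))) (ℕ.+-mono-≤ (f≤ y) (total-concatMap f≤ ys))

  -- Blocks lie in different classes, so they are disjoint and their concatenation is still
  -- duplicate-free. A block may be a proper part of its class, which is how long facial walks are
  -- handled.
  total-classes : ∀ {m c ys} (class : A → Fin m) (block : Fin m → List A) →
                  (∀ i → Unique (block i)) → (∀ i {x} → x ∈ block i → class x ≡ i) →
                  (∀ i → c ℕ.≤ total (block i)) → (∀ x → x ∈ ys) → m ℕ.* c ℕ.≤ total ys
  total-classes {m} {c} class block uniq class-block c≤ complete = ℕ.≤-trans
    (ℕ.≤-reflexive (cong (ℕ._* c) (sym (length-tabulate block))))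
    (ℕ.≤-trans (total-concat (All.tabulate⁺ {f = block} c≤))
               (total-mono (Unique.concat⁺ (All.tabulate⁺ uniq) disjoint) λ {x} _ → complete x))
    where
      disjoint = AllPairs.tabulate⁺ {f = block} λ {i} {j} i≢j {x} (x∈i , x∈j) →
        i≢j (trans (sym (class-block i x∈i)) (class-block j x∈j))

-- Simple graphs, with criteria for containing `K₄` or `C₅`.

module _ {n : ℕ} (G : SimpleGraph n) where
  open SimpleGraph G

  Adj-sym : ∀ {u v} → Adj u v → Adj v u
  Adj-sym {u} {v} = subst T (adj-sym u v)

  Adj⇒≢ : ∀ {u v} → Adj u v → u ≢ v
  Adj⇒≢ {u} u~u refl = subst T (adj-irrefl u) u~u

  -- Otherwise the neighbourhood of `v` would be inside a set of at most two vertices.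
  third-neighbour : ∀ {v} → 3 ℕ.≤ degree v → ∀ a b → ∃[ c ] (Adj v c × c ≢ a × c ≢ b)
  third-neighbour {v} 3≤deg a b
    with any? (λ c → T? (adj v c) ×-dec (¬? (c ≟ a) ×-dec ¬? (c ≟ b)))
  ... | yes found = found
  ... | no  none  = ⊥-elim (ℕ.<⇒≱ 3≤deg (begin
    ∣ neighbours v ∣           ≤⟨ p⊆q⇒∣p∣≤∣q∣ N⊆ ⟩
    ∣ ⁅ a ⁆ ∪ ⁅ b ⁆ ∣          ≤⟨ ∣p∪q∣≤∣p∣+∣q∣ ⁅ a ⁆ ⁅ b ⁆ ⟩
    ∣ ⁅ a ⁆ ∣ ℕ.+ ∣ ⁅ b ⁆ ∣    ≡⟨ cong₂ ℕ._+_ (∣⁅x⁆∣≡1 a) (∣⁅x⁆∣≡1 b) ⟩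
    2                          ∎))
    where
      open ℕ.≤-Reasoning
      N⊆ : neighbours v ⊆ₛ ⁅ a ⁆ ∪ ⁅ b ⁆
      N⊆ {c} c∈N with c ≟ a | c ≟ b
      ... | yes refl | _        = x∈p∪q⁺ (inj₁ (x∈⁅x⁆ a))
      ... | no _     | yes refl = x∈p∪q⁺ (inj₂ (x∈⁅x⁆ b))
      ... | no c≢a   | no c≢b   = ⊥-elim (none (c ,
        Equivalence.from T-≡ (trans (sym (lookup∘tabulate (adj v) c)) ([]=⇒lookup c∈N)) , c≢a , c≢b))

  K₄-subgraph : ∀ {a b c d} → Adj a b → Adj a c → Adj a d → Adj b c → Adj b d → Adj c d → K₄ ⊑ G
  K₄-subgraph {a} {b} {c} {d} ab ac ad bc bd cd = f , f-injective , hom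
    where
      f : Fin 4 → Fin n
      f = lookup (a ∷ b ∷ c ∷ d ∷ [])

      hom : ∀ i j → SimpleGraph.Adj K₄ i j → Adj (f i) (f j)
      hom 0F 1F _ = ab
      hom 0F 2F _ = ac
      hom 0F 3F _ = ad
      hom 1F 0F _ = Adj-sym ab
      hom 1F 2F _ = bc
      hom 1F 3F _ = bd
      hom 2F 0F _ = Adj-sym ac
      hom 2F 1F _ = Adj-sym bc
      hom 2F 3F _ = cd
      hom 3F 0F _ = Adj-sym ad
      hom 3F 1F _ = Adj-sym bd
      hom 3F 2F _ = Adj-sym cd
      hom 3F 3F ()

      K₄-complete : ∀ {i j} → i ≢ j → SimpleGraph.Adj K₄ i j
      K₄-complete {i} {j} i≢j with i ≟ j
      ... | yes i≡j = i≢j i≡j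
      ... | no  _   = _

      f-injective : Injective _≡_ _≡_ f
      f-injective {i} {j} fi≡fj with i ≟ j
      ... | yes i≡j = i≡j
      -- Distinct vertices of `K₄` are adjacent, so injectivity follows from irreflexivity in `G`.
      ... | no  i≢j = ⊥-elim (Adj⇒≢ (hom i j (K₄-complete i≢j)) fi≡fj)

  -- The five inequalities are for the pairs not consecutive on the cycle; consecutive vertices
  -- differ by irreflexivity.
  C₅-subgraph : ∀ {a b c d e} → Adj a b → Adj b c → Adj c d → Adj d e → Adj e a →
                a ≢ c → b ≢ d → c ≢ e → d ≢ a → e ≢ b → C₅ ⊑ G
  C₅-subgraph {a} {b} {c} {d} {e} ab bc cd de ea a≢c b≢d c≢e d≢a e≢b = f , f-injective , hom
    where
      f : Fin 5 → Fin n
      f = lookup (a ∷ b ∷ c ∷ d ∷ e ∷ [])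

      hom : ∀ i j → SimpleGraph.Adj C₅ i j → Adj (f i) (f j)
      hom 0F 1F _ = ab
      hom 1F 0F _ = Adj-sym ab
      hom 1F 2F _ = bc
      hom 2F 1F _ = Adj-sym bc
      hom 2F 3F _ = cd
      hom 3F 2F _ = Adj-sym cd
      hom 3F 4F _ = de
      hom 4F 3F _ = Adj-sym de
      hom 4F 0F _ = ea
      hom 0F 4F _ = Adj-sym ea
      hom 1F 3F ()
      hom 1F 4F ()
      hom 2F 4F ()
      hom 4F 4F ()

      f-injective : Injective _≡_ _≡_ f
      f-injective {0F} {0F} _  = refl
      f-injective {0F} {1F} eq = ⊥-elim (Adj⇒≢ ab eq)
      f-injective {0F} {2F} eq = ⊥-elim (a≢c eq)
      f-injective {0F} {3F} eq = ⊥-elim (d≢a (sym eq))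
      f-injective {0F} {4F} eq = ⊥-elim (Adj⇒≢ ea (sym eq))
      f-injective {1F} {1F} _  = refl
      f-injective {1F} {2F} eq = ⊥-elim (Adj⇒≢ bc eq)
      f-injective {1F} {3F} eq = ⊥-elim (b≢d eq)
      f-injective {1F} {4F} eq = ⊥-elim (e≢b (sym eq))
      f-injective {2F} {2F} _  = refl
      f-injective {2F} {3F} eq = ⊥-elim (Adj⇒≢ cd eq)
      f-injective {2F} {4F} eq = ⊥-elim (c≢e eq)
      f-injective {3F} {3F} _  = refl
      f-injective {3F} {4F} eq = ⊥-elim (Adj⇒≢ de eq)
      f-injective {4F} {4F} _  = refl
      f-injective {1F} {0F} eq = ⊥-elim (Adj⇒≢ ab (sym eq))
      f-injective {2F} {0F} eq = ⊥-elim (a≢c (sym eq))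
      f-injective {3F} {0F} eq = ⊥-elim (d≢a eq)
      f-injective {4F} {0F} eq = ⊥-elim (Adj⇒≢ ea eq)
      f-injective {2F} {1F} eq = ⊥-elim (Adj⇒≢ bc (sym eq))
      f-injective {3F} {1F} eq = ⊥-elim (b≢d (sym eq))
      f-injective {4F} {1F} eq = ⊥-elim (e≢b eq)
      f-injective {3F} {2F} eq = ⊥-elim (Adj⇒≢ cd (sym eq))
      f-injective {4F} {2F} eq = ⊥-elim (c≢e (sym eq))
      f-injective {4F} {3F} eq = ⊥-elim (Adj⇒≢ de (sym eq))

  -- Darts and their enumeration by edges.

  open Dart

  Dart-Adj : (d : Dart) → Adj (tail d) (head d)
  Dart-Adj (dart u v u~v) = recompute (T? (adj u v)) u~v

  Dart-≡ : {d d′ : Dart} → tail d ≡ tail d′ → head d ≡ head d′ → d ≡ d′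
  Dart-≡ refl refl = refl

  _≟ᵈ_ : (d d′ : Dart) → Dec (d ≡ d′)
  d ≟ᵈ d′ = map′ (λ (t , h) → Dart-≡ t h) (λ { refl → refl , refl })
                 ((tail d ≟ tail d′) ×-dec (head d ≟ head d′))

  reverse-injective : Injective _≡_ _≡_ reverse
  -- `reverse (reverse d)` is definitionally `d`, by eta and irrelevance of the adjacency proof.
  reverse-injective = cong reverse

  -- Entries of `edges` are bare pairs without an adjacency proof, so adjacency is decided again;
  -- the pairs in `edges` all take the first branch.
  dartsOf : Fin n × Fin n → List Dart
  dartsOf (u , v) with T? (adj u v)
  ... | yes u~v = dart u v u~v ∷ dart v u (Adj-sym u~v) ∷ []
  ... | no  _   = []

  darts : List Dart
  darts = concatMap dartsOf edges

  ∈-darts : ∀ d → d ∈ darts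
  ∈-darts d@(dart u v _) = ∈-concatMap⁺ dartsOf place
    where
      u~v = Dart-Adj d

      listed : ∀ {x y} → x Fin.< y → Adj x y → (x , y) ∈ edges
      listed {x} {y} x<y x~y = ∈-filter⁺ _ (∈-cartesianProduct⁺ (∈-allFin x) (∈-allFin y)) (x<y , x~y)

      forwards : d ∈ dartsOf (u , v)
      forwards with T? (adj u v)
      ... | yes _  = here refl
      ... | no u≁v = ⊥-elim (u≁v u~v)

      backwards : d ∈ dartsOf (v , u)
      backwards with T? (adj v u)
      ... | yes _  = there (here refl)
      ... | no v≁u = ⊥-elim (v≁u (Adj-sym u~v))

      place : Any.Any (λ p → d ∈ dartsOf p) edges
      place with <-cmp u v
      ... | tri< u<v _ _ = Any.map (λ { refl → forwards }) (listed u<v u~v)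
      ... | tri≈ _ u≡v _ = ⊥-elim (Adj⇒≢ u~v u≡v)
      ... | tri> _ _ v<u = Any.map (λ { refl → backwards }) (listed v<u (Adj-sym u~v))

  total-darts : (w : Dart → ℕ) {c : ℕ} → (∀ d → w d ℕ.+ w (reverse d) ℕ.≤ c) →
                total w darts ℕ.≤ e ℕ.* c
  total-darts w {c} w≤ = total-concatMap w bound edges
    where
      bound : ∀ p → total w (dartsOf p) ℕ.≤ c
      bound (u , v) with T? (adj u v)
      ... | yes u~v = subst (λ s → w (dart u v u~v) ℕ.+ s ℕ.≤ c) (sym (ℕ.+-identityʳ _)) (w≤ (dart u v u~v))
      ... | no  _   = z≤n

-- Charges of single darts and of edges.

-- The charge of a dart, where P, P′ say that it, respectively its reverse, is on
-- a triangular face, and Q that it is on a quadrangular one.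
charge : {P P′ Q : Set} → Dec P → Dec P′ → Dec Q → ℕ
charge (yes _) (yes _) _       = 8
charge (yes _) (no  _) _       = 11
charge (no  _) _       (yes _) = 8
charge (no  _) _       (no  _) = 5

module _ {P P′ Q : Set} where

  charge≥5 : (p : Dec P) (p′ : Dec P′) (q : Dec Q) → 5 ℕ.≤ charge p p′ q
  charge≥5 (yes _) (yes _) _       = ℕ.m≤m+n 5 _
  charge≥5 (yes _) (no  _) _       = ℕ.m≤m+n 5 _
  charge≥5 (no  _) _       (yes _) = ℕ.m≤m+n 5 _
  charge≥5 (no  _) _       (no  _) = ℕ.m≤m+n 5 _

  charge≥8 : (p : Dec P) (p′ : Dec P′) (q : Dec Q) → P ⊎ Q → 8 ℕ.≤ charge p p′ q
  charge≥8 (yes _)  (yes _) _       _        = ℕ.m≤m+n 8 _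
  charge≥8 (yes _)  (no  _) _       _        = ℕ.m≤m+n 8 _
  charge≥8 (no  _)  _       (yes _) _        = ℕ.m≤m+n 8 _
  charge≥8 (no ¬p)  _       (no  _) (inj₁ p) = ⊥-elim (¬p p)
  charge≥8 (no  _)  _       (no ¬q) (inj₂ q) = ⊥-elim (¬q q)

  charge≥11 : (p : Dec P) (p′ : Dec P′) (q : Dec Q) → P → ¬ P′ → 11 ℕ.≤ charge p p′ q
  charge≥11 (yes _) (yes p′) _ _ ¬p′ = ⊥-elim (¬p′ p′)
  charge≥11 (yes _) (no  _)  _ _ _   = ℕ.≤-refl
  charge≥11 (no ¬p) _        _ p _   = ⊥-elim (¬p p)

-- If exactly one of the two darts is on a triangular face, the hypotheses exclude a quadrangular
-- face on the other side, so the charges are 11 and 5. Otherwise neither dart receives anything and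
-- each has at most 8.
charge-edge : {P P′ Q Q′ : Set} (p : Dec P) (p′ : Dec P′) (q : Dec Q) (q′ : Dec Q′) →
              ¬ (P × Q′) → ¬ (P′ × Q) → charge p p′ q ℕ.+ charge p′ p q′ ℕ.≤ 16
charge-edge (yes _) (yes _) _       _       _  _  = ℕ.≤-refl
charge-edge (yes p) (no  _) _       (yes q) ¬a _  = ⊥-elim (¬a (p , q))
charge-edge (yes _) (no  _) _       (no  _) _  _  = ℕ.≤-refl
charge-edge (no  _) (yes p) (yes q) _       _  ¬b = ⊥-elim (¬b (p , q))
charge-edge (no  _) (yes _) (no  _) _       _  _  = ℕ.≤-refl
charge-edge (no  _) (no  _) (yes _) (yes _) _  _  = ℕ.≤-refl
charge-edge (no  _) (no  _) (yes _) (no  _) _  _  = ℕ.m≤m+n 13 3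
charge-edge (no  _) (no  _) (no  _) (yes _) _  _  = ℕ.m≤m+n 13 3
charge-edge (no  _) (no  _) (no  _) (no  _) _  _  = ℕ.m≤m+n 10 6

-- Rotations and short facial walks under minimum degree 3.

module _ {n : ℕ} (G : PlaneGraph n) (3≤degree : ∀ v → 3 ℕ.≤ PlaneGraph.degree G v) where
  open PlaneGraph G
  open Dart

  private
    φ : Dart → Dart
    φ = nextOnFace

  φ-injective : Injective _≡_ _≡_ φ
  φ-injective = reverse-injective graph ∘ rotate-injective

  tail-rotate : ∀ d → tail (rotate d) ≡ tail d
  tail-rotate d = sym (Equivalence.to (rotate-orbits d (rotate d)) (1 , refl))

  tail-φ : ∀ d → tail (φ d) ≡ head d
  tail-φ d = tail-rotate (reverse d)

  -- Otherwise the orbit of `d` would be just `d` and `rotate d`, whereas it contains the dart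
  -- towards a third neighbour of `tail d`.
  rotate²≢id : ∀ d → rotate (rotate d) ≢ d
  rotate²≢id d eq with third-neighbour graph (3≤degree (tail d)) (head d) (head (rotate d))
  ... | c , u~c , c≢h , c≢h′ with Equivalence.from (rotate-orbits d (dart (tail d) c u~c)) refl
  ...   | k , orbit with two k
    where
      two : ∀ k → iterate rotate d k ≡ d ⊎ iterate rotate d k ≡ rotate d
      two 0             = inj₁ refl
      two 1             = inj₂ refl
      two (suc (suc k)) rewrite eq = two k
  ...     | inj₁ ≡d  = c≢h (cong head (trans (sym orbit) ≡d))
  ...     | inj₂ ≡rd = c≢h′ (cong head (trans (sym orbit) ≡rd))

  rotate≢id : ∀ d → rotate d ≢ d
  rotate≢id d eq = rotate²≢id d (trans (cong rotate eq) eq)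

  step : ∀ d → Adj (head d) (head (φ d))
  step d = subst (λ u → Adj u (head (φ d))) (tail-φ d) (Dart-Adj graph (φ d))

  -- Turning back would make `reverse d` a fixed point of `rotate`.
  no-backtrack : ∀ d → head (φ d) ≢ tail d
  no-backtrack d eq = rotate≢id (reverse d) (Dart-≡ graph (tail-φ d) eq)

  no-backtrack′ : ∀ d → head d ≢ head (φ (φ d))
  no-backtrack′ d eq = no-backtrack (φ d) (trans (sym eq) (sym (tail-φ d)))

  φ≢id : ∀ d → d ≢ φ d
  φ≢id d eq = Adj⇒≢ graph (step d) (cong head eq)

  φ²≢id : ∀ d → d ≢ φ (φ d)
  φ²≢id d eq = no-backtrack′ d (cong head eq)

  -- The rotation at v = head d sends v → tail d to φ d and then to the dart on the
  -- right, so equality would make v a vertex of degree 2.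
  opposite≢ : ∀ d → tail d ≢ head (φ (reverse (φ d)))
  opposite≢ d eq = rotate²≢id (reverse d)
    (Dart-≡ graph (trans (tail-rotate (φ d)) (tail-φ d)) (sym eq))

  -- By `φ≢id` and `φ²≢id`, the return times 3 and 4 are exact periods of `φ`.
  Triangular Quadrangular : Dart → Set
  Triangular   d = φ (φ (φ d)) ≡ d
  Quadrangular d = φ (φ (φ (φ d))) ≡ d

  triangular? : ∀ d → Dec (Triangular d)
  triangular? d = _≟ᵈ_ graph _ d

  quadrangular? : ∀ d → Dec (Quadrangular d)
  quadrangular? d = _≟ᵈ_ graph _ d

  triangle-close : ∀ {d} → Triangular d → Adj (head (φ d)) (tail d)
  triangle-close {d} t = subst (Adj (head (φ d))) (trans (sym (tail-φ (φ (φ d)))) (cong tail t)) (step (φ d))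

  -- In a closed walk of length 5, any two nonconsecutive positions are two steps apart, so the
  -- absence of backtracking already makes the walk a cycle.
  no-pentagon : ¬ (C₅ ⊑ graph) → ∀ d → φ (φ (φ (φ (φ d)))) ≢ d
  no-pentagon ¬C₅ d eq = ¬C₅ (C₅-subgraph graph
    (step d) (step (φ d)) (step (φ (φ d))) (step (φ (φ (φ d))))
    (subst (λ x → Adj (head (φ (φ (φ (φ d))))) (head x)) eq (step (φ (φ (φ (φ d))))))
    (no-backtrack′ d) (no-backtrack′ (φ d)) (no-backtrack′ (φ (φ d)))
    (subst (λ x → head (φ (φ (φ d))) ≢ head x) eq (no-backtrack′ (φ (φ (φ d)))))
    (subst (λ x → head (φ (φ (φ (φ d)))) ≢ head (φ x)) eq (no-backtrack′ (φ (φ (φ (φ d)))))))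

  -- Let `x` and `y` be the apexes of the triangles across `ab` and `bc`. If they coincide, that
  -- vertex is joined to all of `a`, `b`, `c`, giving a `K₄`; if not, `a x b y c` is a 5-cycle.
  triangle-two-triangles : ¬ (K₄ ⊑ graph) → ¬ (C₅ ⊑ graph) → ∀ d →
    Triangular d → Triangular (reverse d) → ¬ Triangular (reverse (φ d))
  triangle-two-triangles ¬K₄ ¬C₅ d t tᵣ tᵣ′ = contra
    where
      a = tail d
      b = head d
      c = head (φ d)
      x = head (φ (reverse d))
      y = head (φ (reverse (φ d)))

      a~b : Adj a b
      a~b = Dart-Adj graph d
      b~c : Adj b c
      b~c = step d
      c~a : Adj c a
      c~a = triangle-close t
      a~x : Adj a x
      a~x = step (reverse d)
      x~b : Adj x b
      x~b = triangle-close tᵣ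
      b~y : Adj b y
      b~y = subst (λ u → Adj u y) (tail-φ d) (step (reverse (φ d)))
      y~c : Adj y c
      y~c = triangle-close tᵣ′

      -- `opposite≢` is applied to `φ (φ d)`, whose tail is `c` and whose successor is `d` by `t`.
      c≢x : c ≢ x
      c≢x = subst₂ (λ u e → u ≢ head (φ (reverse e))) (tail-φ (φ d)) t (opposite≢ (φ (φ d)))
      a≢y : a ≢ y
      a≢y = opposite≢ d

      contra : ⊥
      contra with x ≟ y
      ... | yes x≡y = ¬K₄ (K₄-subgraph graph a~b (Adj-sym graph c~a) a~x b~c (Adj-sym graph x~b)
                            (subst (Adj c) (sym x≡y) (Adj-sym graph y~c)))
      ... | no  x≢y = ¬C₅ (C₅-subgraph graph a~x x~b b~y y~c c~a
                            (Adj⇒≢ graph a~b) x≢y (Adj⇒≢ graph b~c) (≢-sym a≢y) c≢x)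

  -- With triangle `a b c` and quadrangle `b a x y`, dropping the common edge `ab` leaves the
  -- 5-cycle `c a x y b`. Its apex `c` differs from `x` and `y` by the rotations at `a` and `b`.
  triangle-quadrangle : ¬ (C₅ ⊑ graph) → ∀ d → Triangular d → ¬ Quadrangular (reverse d)
  triangle-quadrangle ¬C₅ d t q = ¬C₅ (C₅-subgraph graph
    (triangle-close t) (step (reverse d)) (step d₁)
    (subst (Adj y) y→b (step d₂)) (step d)
    c≢x (no-backtrack′ (reverse d))
    (no-backtrack (reverse d))
    y≢c (Adj⇒≢ graph (Adj-sym graph (Dart-Adj graph d))))
    where
      d₁ = φ (reverse d)
      d₂ = φ d₁
      y = head d₂

      y→b : head (φ d₂) ≡ head d
      y→b = trans (sym (tail-φ (φ d₂))) (cong tail q)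

      c≢x : head (φ d) ≢ head d₁
      c≢x = subst₂ (λ u e → u ≢ head (φ (reverse e))) (tail-φ (φ d)) t (opposite≢ (φ (φ d)))

      -- `φ d₂` runs from `y` to `b = head d`, and `q` makes `reverse d` its successor.
      y≢c : y ≢ head (φ d)
      y≢c = subst₂ (λ u e → u ≢ head (φ (reverse e))) (tail-φ d₂) q (opposite≢ (φ d₂))

  -- Weights of edges and of facial walks.

  weight : Dart → ℕ
  weight d = charge (triangular? d) (triangular? (reverse d)) (quadrangular? d)

  weight≥5 : ∀ d → 5 ℕ.≤ weight d
  weight≥5 d = charge≥5 (triangular? d) (triangular? (reverse d)) (quadrangular? d)

  weight≥8 : ∀ d → Triangular d ⊎ Quadrangular d → 8 ℕ.≤ weight d
  weight≥8 d = charge≥8 (triangular? d) (triangular? (reverse d)) (quadrangular? d)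

  weight≥11 : ∀ d → Triangular d → ¬ Triangular (reverse d) → 11 ℕ.≤ weight d
  weight≥11 d = charge≥11 (triangular? d) (triangular? (reverse d)) (quadrangular? d)

  walk : Dart → ℕ → List Dart
  walk d = applyUpTo (iterate φ d)

  module _ (¬K₄ : ¬ (K₄ ⊑ graph)) (¬C₅ : ¬ (C₅ ⊑ graph)) where

    weight-edge : ∀ d → weight d ℕ.+ weight (reverse d) ℕ.≤ 16
    weight-edge d = charge-edge (triangular? d) (triangular? (reverse d)) (quadrangular? d) (quadrangular? (reverse d))
      (λ (t , q) → triangle-quadrangle ¬C₅ d t q)
      (λ (t , q) → triangle-quadrangle ¬C₅ (reverse d) t q)

    -- Any two darts of a triangle are cyclically consecutive, so at most one of the three has a
    -- triangular reverse. Deciding this for two of them shows which dart may have only 8; the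
    -- others have 11.
    weight-triangle : ∀ d → Triangular d → 30 ℕ.≤ total weight (walk d 3)
    weight-triangle d t = body (triangular? (reverse d)) (triangular? (reverse d₁))
      where
        d₁ = φ d
        d₂ = φ d₁
        t₁ : Triangular d₁
        t₁ = cong φ t
        t₂ : Triangular d₂
        t₂ = cong φ t₁

        sum₃ : ∀ {i j k} → i ℕ.≤ weight d → j ℕ.≤ weight d₁ → k ℕ.≤ weight d₂ →
               i ℕ.+ (j ℕ.+ (k ℕ.+ 0)) ℕ.≤ total weight (walk d 3)
        sum₃ i≤ j≤ k≤ = ℕ.+-mono-≤ i≤ (ℕ.+-mono-≤ j≤ (ℕ.+-monoˡ-≤ 0 k≤))

        body : Dec (Triangular (reverse d)) → Dec (Triangular (reverse d₁)) → 30 ℕ.≤ total weight (walk d 3)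
        body (yes r) _ = sum₃ (weight≥8 d (inj₁ t))
          (weight≥11 d₁ t₁ (triangle-two-triangles ¬K₄ ¬C₅ d t r))
          -- Here `d₂` comes first and its successor `φ d₂` is `d` by `t`, so `r` has to be
          -- transported to `φ d₂`.
          (weight≥11 d₂ t₂ λ r₂ → triangle-two-triangles ¬K₄ ¬C₅ d₂ t₂ r₂ (subst (Triangular ∘ reverse) (sym t) r))
        body (no ¬r) (yes r₁) = sum₃ (weight≥11 d t ¬r) (weight≥8 d₁ (inj₁ t₁))
          (weight≥11 d₂ t₂ (triangle-two-triangles ¬K₄ ¬C₅ d₁ t₁ r₁))
        body (no ¬r) (no ¬r₁) = sum₃ (weight≥11 d t ¬r) (weight≥11 d₁ t₁ ¬r₁) (weight≥8 d₂ (inj₁ t₂))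

    weight-quadrangle : ∀ d → Quadrangular d → 30 ℕ.≤ total weight (walk d 4)
    weight-quadrangle d q = ℕ.≤-trans (ℕ.m≤m+n 30 2)
      (ℕ.+-mono-≤ (weight≥8 d (inj₂ q)) (ℕ.+-mono-≤ (weight≥8 (φ d) (inj₂ (cong φ q)))
      (ℕ.+-mono-≤ (weight≥8 (φ (φ d)) (inj₂ (cong (φ ∘ φ) q)))
      (ℕ.+-monoˡ-≤ 0 (weight≥8 (φ (φ (φ d))) (inj₂ (cong (φ ∘ φ ∘ φ) q)))))))

    weight-walk : ∀ d k → k ℕ.* 5 ℕ.≤ total weight (walk d k)
    weight-walk d zero    = z≤n
    weight-walk d (suc k) = ℕ.+-mono-≤ (weight≥5 d) (weight-walk (φ d) k)

    -- For a short face `k` is its length, 3 or 4. Otherwise the period exceeds 5, and the first six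
    -- darts, distinct and of weight at least 5 each, already reach 30 however long the walk is.
    heavy-walk : ∀ d → ∃[ k ] (Unique (walk d k) × 30 ℕ.≤ total weight (walk d k))
    heavy-walk d = body (triangular? d) (quadrangular? d)
      where
        body : Dec (Triangular d) → Dec (Quadrangular d) →
               ∃[ k ] (Unique (walk d k) × 30 ℕ.≤ total weight (walk d k))
        body (yes t) _ = 3 , iterate-unique φ-injective d 3 aperiodic , weight-triangle d t
          where
            aperiodic : ∀ m → 0 ℕ.< m → m ℕ.< 3 → d ≢ iterate φ d m
            aperiodic 1 _ _ = φ≢id d
            aperiodic 2 _ _ = φ²≢id d
            aperiodic (suc (suc (suc _))) _ (s≤s (s≤s (s≤s ())))
        body (no ¬t) (yes q) = 4 , iterate-unique φ-injective d 4 aperiodic , weight-quadrangle d q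
          where
            aperiodic : ∀ m → 0 ℕ.< m → m ℕ.< 4 → d ≢ iterate φ d m
            aperiodic 1 _ _ = φ≢id d
            aperiodic 2 _ _ = φ²≢id d
            aperiodic 3 _ _ = ≢-sym ¬t
            aperiodic (suc (suc (suc (suc _)))) _ (s≤s (s≤s (s≤s (s≤s ()))))
        body (no ¬t) (no ¬q) = 6 , iterate-unique φ-injective d 6 aperiodic , weight-walk d 6
          where
            aperiodic : ∀ m → 0 ℕ.< m → m ℕ.< 6 → d ≢ iterate φ d m
            aperiodic 1 _ _ = φ≢id d
            aperiodic 2 _ _ = φ²≢id d
            aperiodic 3 _ _ = ≢-sym ¬t
            aperiodic 4 _ _ = ≢-sym ¬q
            aperiodic 5 _ _ = ≢-sym (no-pentagon ¬C₅ d)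
            aperiodic (suc (suc (suc (suc (suc (suc _)))))) _ (s≤s (s≤s (s≤s (s≤s (s≤s (s≤s ()))))))

    -- The total weight of all darts is counted twice: at least 30 per facial walk, at most 16 per
    -- edge.
    facialWalks-bound : Classes.count facialWalks ℕ.* 30 ℕ.≤ e ℕ.* 16
    facialWalks-bound = ℕ.≤-trans
      (total-classes weight class (λ i → walk (rep i) (size i))
        (λ i → proj₁ (proj₂ (heavy-walk (rep i)))) class-walk
        (λ i → proj₂ (proj₂ (heavy-walk (rep i)))) (∈-darts graph))
      (total-darts graph weight weight-edge)
      where
        open Classes facialWalks

        rep : Fin count → Dart
        rep i = proj₁ (surjective i)

        size : Fin count → ℕ
        size i = proj₁ (heavy-walk (rep i))

        class-walk : ∀ i {d} → d ∈ walk (rep i) (size i) → class d ≡ i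
        class-walk i {d} d∈ with ∈-applyUpTo⁻ (iterate φ (rep i)) d∈
        ... | k , _ , d≡ = trans (sym (Equivalence.from (class-≡ (rep i) d) (k , sym d≡)))
                                 (proj₂ (surjective i) refl)

    -- Euler's formula and the edge bound.

    no-isolated : isolated ≡ []
    no-isolated = filter-none _ (All.universal (λ v deg≡0 → ℕ.<⇒≢ (ℕ.≤-trans (s≤s z≤n) (3≤degree v)) (sym deg≡0)) (allFin n))

    edge-bound : Fin n → 7 ℕ.* e ℕ.+ 30 ℕ.≤ 15 ℕ.* n
    -- The chain is `30 (e + 2) ≤ 30 (n + f) ≤ 30 n + 16 e`; to avoid subtraction, `16 e` is
    -- cancelled from both sides and then a factor 2. The vertex `v` ensures that there is at least
    -- one component.
    edge-bound v = ℕ.*-cancelˡ-≤ 2 (ℕ.+-cancelʳ-≤ (16 ℕ.* e) _ _ (begin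
      2 ℕ.* (7 ℕ.* e ℕ.+ 30) ℕ.+ 16 ℕ.* e
        ≡⟨ solve 1 (λ e → con 2 :* (con 7 :* e :+ con 30) :+ con 16 :* e := con 30 :* (e :+ con 2 :* con 1)) refl e ⟩
      30 ℕ.* (e ℕ.+ 2 ℕ.* 1)
        ≤⟨ ℕ.*-monoʳ-≤ 30 (ℕ.+-monoʳ-≤ e (ℕ.*-monoʳ-≤ 2 (inhabited (Classes.class components v)))) ⟩
      30 ℕ.* (e ℕ.+ 2 ℕ.* Classes.count components)
        ≡⟨ cong (30 ℕ.*_) (sym euler) ⟩
      30 ℕ.* (n ℕ.+ (f ℕ.+ length isolated))
        ≡⟨ cong (λ l → 30 ℕ.* (n ℕ.+ (f ℕ.+ length l))) no-isolated ⟩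
      30 ℕ.* (n ℕ.+ (f ℕ.+ 0))
        ≡⟨ solve 2 (λ n f → con 30 :* (n :+ (f :+ con 0)) := con 2 :* (con 15 :* n) :+ f :* con 30) refl n f ⟩
      2 ℕ.* (15 ℕ.* n) ℕ.+ f ℕ.* 30
        ≤⟨ ℕ.+-monoʳ-≤ (2 ℕ.* (15 ℕ.* n)) facialWalks-bound ⟩
      2 ℕ.* (15 ℕ.* n) ℕ.+ e ℕ.* 16
        ≡⟨ cong (2 ℕ.* (15 ℕ.* n) ℕ.+_) (ℕ.*-comm e 16) ⟩
      2 ℕ.* (15 ℕ.* n) ℕ.+ 16 ℕ.* e ∎))
      where
        open ℕ.≤-Reasoning
        open +-*-Solver
        f = Classes.count facialWalks

        inhabited : ∀ {c} → Fin c → 1 ℕ.≤ c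
        inhabited Fin.zero    = s≤s z≤n
        inhabited (Fin.suc _) = s≤s z≤n

-- From natural numbers to the rational inequality.

≤-15/7 : ∀ m k → 7 ℕ.* m ℕ.≤ 15 ℕ.* k → + m / 1 ≤ (+ 15 / 7) * (+ k / 1)
-- In unnormalised rationals no fraction is reduced, so the inequality is plain cross
-- multiplication.
≤-15/7 m k 7m≤15k = ℚ.toℚᵘ-cancel-≤ (begin
  toℚᵘ (+ m / 1)                       ≃⟨ ℚ.toℚᵘ-fromℚᵘ (mkℚᵘ (+ m) 0) ⟩
  mkℚᵘ (+ m) 0                         ≤⟨ *≤* cross ⟩
  mkℚᵘ (+ 15) 6 ℚᵘ.* mkℚᵘ (+ k) 0      ≃⟨ ℚᵘ.*-congˡ {mkℚᵘ (+ 15) 6} (ℚ.toℚᵘ-fromℚᵘ (mkℚᵘ (+ k) 0)) ⟨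
  toℚᵘ (+ 15 / 7) ℚᵘ.* toℚᵘ (+ k / 1)  ≃⟨ ℚ.toℚᵘ-homo-* (+ 15 / 7) (+ k / 1) ⟨
  toℚᵘ ((+ 15 / 7) * (+ k / 1))        ∎)
  where
    open ℚᵘ.≤-Reasoning
    cross : + m ℤ.* + 7 ℤ.≤ + 15 ℤ.* + k ℤ.* + 1
    cross = subst₂ ℤ._≤_ (trans (cong +_ (ℕ.*-comm 7 m)) (ℤ.pos-* m 7))
                         (trans (ℤ.pos-* 15 k) (sym (ℤ.*-identityʳ _))) (ℤ.+≤+ 7m≤15k)

theorem1 : (n : ℕ) (G : PlaneGraph n) →
    5 ℕ.≤ n →
    (∀ v → 3 ℕ.≤ PlaneGraph.degree G v) →
    ¬ (K₄ ⊑ PlaneGraph.graph G) →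
    ¬ (C₅ ⊑ PlaneGraph.graph G) →
    + PlaneGraph.e G / 1 ≤ (+ 15 / 7) * ((+ n ℤ.- + 2) / 1)
theorem1 (suc (suc k)) G (s≤s (s≤s _)) 3≤degree ¬K₄ ¬C₅ = ≤-15/7 (PlaneGraph.e G) k
  -- With `n = 2 + k`, `+ n - + 2` computes to `+ k`, and `15 n = 15 k + 30` matches the 30 in
  -- `edge-bound`.
  (ℕ.+-cancelʳ-≤ 30 _ _ (ℕ.≤-trans (edge-bound G 3≤degree ¬K₄ ¬C₅ Fin.zero)
    (ℕ.≤-reflexive (solve 1 (λ k → con 15 :* (con 2 :+ k) := con 15 :* k :+ con 30) refl k))))
  where open +-*-Solver
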